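{- If the layerwidth of a DAG $G$ is $w$, then the treewidth of $G$ is less than or equal to $2w-1$. Furthermore, this bound is tight: for every integer $w\ge1$ there exists a DAG $G$ with layerwidth $w$ and treewidth $2w-1$.
   Context: All graphs are finite and have at least one node. A layer decomposition of a DAG $G=(V,A)$ is a list $((T^0,S^0),\dots,(T^k,S^k))$ of pairs of subsets of $V$ such that: (D1) $(T^0,\dots,T^k)$ is an ordered partition of $V$ (into nonempty blocks); (D2) $S^i\subseteq T^i$ for every $i\in\{0,\dots,k\}$; (D3) for every $i\in\{0,\dots,k-1\}$, no two variables $X\in T^0\cup\dots\cup T^{i-1}\cup(T^i\setminus S^i)$ and $Y\in T^{i+1}\cup\dots\cup T^k$ are connected by an arrow in $G$; (D4) for every $i\in\{1,\dots,k\}$, every child in $G$ of a variable in $S^i$ belongs to $(T^i\setminus S^i)\cup S^{i-1}$, and every child of a variable in $S^0$ belongs to $T^0\setminus S^0$; (D5) for every $i\in\{0,\dots,k-1\}$, every parent in $G$ of a variable in $S^i$ belongs to $T^{i+1}$, and no variable in $S^k$ has a parent. The width of a layer decomposition is the lowest integer $w$ such that $|T^i|\le w$ for every $i\in\{0,\dots,k\}$. The layerwidth of $G$ is the minimum width over all layer decompositions of $G$. Treewidth of a DAG $G=(V,A)$: first moralize $G$, i.e. pairwise connect all parents of every node and then drop the directionality of all edges. An elimination order is any ordering of $V$. To eliminate a variable $X$ from an undirected graph, pairwise connect all neighbors of $X$ and then remove $X$ together with its incident edges. The width of an elimination order $\sigma$ is the maximal number of neighbors that any node has at its point of elimination, when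 the nodes of the moralized graph are eliminated in the order $\sigma$. The treewidth of $G$ is the lowest width among all elimination orders of $G$. -}

module Defs where

open import Data.Fin as Fin using (Fin; zero; suc; inject₁; fromℕ; _≟_)
open import Data.Fin.Properties using (any?)
open import Data.Fin.Subset using (Subset; ∣_∣; ⊤; _∈_; _⊆_; _∪_; _─_; _-_; Nonempty)
open import Data.Fin.Subset.Properties using (∈⊤; x∈p∧x≢y⇒x∈p-y)
open import Data.List using (List; []; _∷_)
import Data.List.Membership.Propositional as List
open import Data.List.Relation.Unary.Unique.Propositional using (Unique)
open import Data.Nat using (ℕ; zero; suc; _≤_; _⊔_; NonZero)
open import Data.Product using (_×_; _,_; proj₁; swap; Σ-syntax; ∃-syntax; map₂)
open import Data.Sum as Sum using (_⊎_; inj₁; inj₂; [_,_]′)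
open import Data.Vec using (tabulate)
open import Function using (_∘_)
open import Level using (0ℓ)
open import Relation.Binary using (Rel; Decidable; Symmetric; Irreflexive)
open import Relation.Binary.Construct.Closure.Transitive using (TransClosure)
open import Relation.Binary.PropositionalEquality using (_≡_; _≢_; refl; sym)
open import Relation.Nullary using (¬_; does; ¬?; _×-dec_; _⊎-dec_)

Least : (ℕ → Set) → ℕ → Set
Least P m = P m × (∀ m′ → P m′ → m ≤ m′)

record DAG : Set₁ where
  infix 4 _⟶_ _⟶?_
  field
    size       : ℕ
    ⦃ nonZero ⦄ : NonZero size
    _⟶_        : Rel (Fin size) 0ℓ
    _⟶?_       : Decidable _⟶_
    acyclic    : ∀ x → ¬ TransClosure _⟶_ x x

record LayerDecomposition (G : DAG) : Set where
  open DAG G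
  field
    k   : ℕ
    T S : Fin (suc k) → Subset size

    T-nonempty : ∀ i → Nonempty (T i)
    T-disjoint : ∀ {i j x} → x ∈ T i → x ∈ T j → i ≡ j
    T-covers   : ∀ x → ∃[ i ] x ∈ T i

    S⊆T : ∀ i → S i ⊆ T i

  -- T⁰ ∪ … ∪ Tⁱ⁻¹ ∪ (Tⁱ ∖ Sⁱ)
  Before : Fin (suc k) → Fin size → Set
  Before i x = (∃[ h ] (h Fin.< i × x ∈ T h)) ⊎ x ∈ T i ─ S i

  -- Tⁱ⁺¹ ∪ … ∪ Tᵏ
  After : Fin (suc k) → Fin size → Set
  After i y = ∃[ j ] (i Fin.< j × y ∈ T j)

  -- For i : Fin k, the layers i and i + 1 are indexed by inject₁ i and suc i.
  field
    no-crossing : ∀ (i : Fin k) {x y} →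
                  Before (inject₁ i) x → After (inject₁ i) y →
                  ¬ (x ⟶ y ⊎ y ⟶ x)

    children-suc  : ∀ (i : Fin k) {x y} → x ∈ S (suc i) → x ⟶ y →
                    y ∈ (T (suc i) ─ S (suc i)) ∪ S (inject₁ i)
    children-zero : ∀ {x y} → x ∈ S zero → x ⟶ y → y ∈ T zero ─ S zero

    parents      : ∀ (i : Fin k) {x y} → x ∈ S (inject₁ i) → y ⟶ x → y ∈ T (suc i)
    parents-last : ∀ {x y} → x ∈ S (fromℕ k) → ¬ (y ⟶ x)

  Width : ℕ → Set
  Width = Least λ w → ∀ i → ∣ T i ∣ ≤ w

IsLayerwidth : DAG → ℕ → Set
IsLayerwidth G = Least λ w → Σ[ D ∈ LayerDecomposition G ] LayerDecomposition.Width D w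

-- A finite simple graph whose node set is a subset of Fin n, so that
-- eliminating a node does not renumber the remaining ones.
record UGraph (n : ℕ) : Set₁ where
  infix 4 _~_ _~?_
  field
    nodes  : Subset n
    _~_    : Rel (Fin n) 0ℓ
    _~?_   : Decidable _~_
    ~-sym  : Symmetric _~_
    ~-irr  : Irreflexive _≡_ _~_
    ~-node : ∀ {u v} → u ~ v → u ∈ nodes

  neighbours : Fin n → Subset n
  neighbours u = tabulate λ v → does (u ~? v)

moralize : (G : DAG) → UGraph (DAG.size G)
moralize G = record
  { nodes  = ⊤
  ; _~_    = λ u v → u ≢ v × (u ⟶ v ⊎ v ⟶ u ⊎ ∃[ z ] (u ⟶ z × v ⟶ z))
  ; _~?_   = λ u v → ¬? (u ≟ v) ×-dec
               ((u ⟶? v) ⊎-dec (v ⟶? u) ⊎-dec any? (λ z → (u ⟶? z) ×-dec (v ⟶? z)))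
  ; ~-sym  = λ { (u≢v , e) → u≢v ∘ sym ,
               [ inj₂ ∘ inj₁ , [ inj₁ , inj₂ ∘ inj₂ ∘ map₂ swap ]′ ]′ e }
  ; ~-irr  = λ u≡v (u≢v , _) → u≢v u≡v
  ; ~-node = λ _ → ∈⊤
  }
  where open DAG G

eliminate : ∀ {n} → Fin n → UGraph n → UGraph n
eliminate x H = record
  { nodes  = nodes - x
  ; _~_    = λ u v → (u ≢ x × v ≢ x × u ≢ v) × (u ~ v ⊎ (x ~ u × x ~ v))
  ; _~?_   = λ u v → (¬? (u ≟ x) ×-dec ¬? (v ≟ x) ×-dec ¬? (u ≟ v)) ×-dec
               ((u ~? v) ⊎-dec ((x ~? u) ×-dec (x ~? v)))
  ; ~-sym  = λ { ((u≢x , v≢x , u≢v) , e) →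
               (v≢x , u≢x , u≢v ∘ sym) , Sum.map ~-sym swap e }
  ; ~-irr  = λ { u≡v ((_ , _ , u≢v) , _) → u≢v u≡v }
  ; ~-node = λ { ((u≢x , _) , e) →
               x∈p∧x≢y⇒x∈p-y ([ ~-node , ~-node ∘ ~-sym ∘ proj₁ ]′ e) u≢x }
  }
  where open UGraph H

eliminationWidth : ∀ {n} → UGraph n → List (Fin n) → ℕ
eliminationWidth H []      = 0
eliminationWidth H (x ∷ σ) =
  ∣ UGraph.neighbours H x ∣ ⊔ eliminationWidth (eliminate x H) σ

IsOrdering : ∀ {n} → List (Fin n) → Set
IsOrdering {n} σ = Unique σ × (∀ (x : Fin n) → x List.∈ σ)

IsTreewidth : DAG → ℕ → Set
IsTreewidth G = Least λ w →
  ∃[ σ ] (IsOrdering σ × eliminationWidth (moralize G) σ ≡ w)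

{-# OPTIONS --safe #-}

-- In a layer decomposition an arrow x ⟶ y has y ∈ Sⁱ and x ∈ Tⁱ⁺¹, or
-- y ∈ Tⁱ ∖ Sⁱ and x ∈ Tⁱ.  All parents of a node thus share a layer, so moral
-- edges join nodes of equal or adjacent layers.  Eliminating layer by layer
-- preserves this, and the node eliminated from layer i only has neighbours in
-- Tⁱ ∪ Tⁱ⁺¹.
--
-- For tightness, take layers of sizes 1, w, w with all arrows from each layer
-- to the preceding one.  The two layers of size w form a clique in the moral
-- graph, and a clique of size m forces every elimination width to be at least
-- m ∸ 1.  By the first part this also bounds the layerwidth from below.

module Submission where

open import Defs
open import Data.Fin as Fin using (Fin; zero; suc; toℕ; inject₁)
import Data.Fin.Properties as Fin
open import Data.Fin.Relation.Unary.Top using (view; ‵fromℕ; ‵inject₁)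
open import Data.Fin.Subset
  using (Subset; inside; outside; ∣_∣; ⊤; ⊥; ⁅_⁆; _∈_; _∉_; _⊆_; _∪_; _─_; _-_; Empty)
open import Data.Fin.Subset.Properties
open import Data.List using ([]; _∷_; allFin)
import Data.List.Membership.Propositional as List
open import Data.List.Membership.Propositional.Properties using (∈-allFin)
open import Data.List.Relation.Binary.Permutation.Propositional using (↭-sym; ↭⇒↭ₛ)
open import Data.List.Relation.Binary.Permutation.Propositional.Properties using (∈-resp-↭)
import Data.List.Relation.Binary.Permutation.Setoid.Properties as Permutationₛ
import Data.List.Relation.Unary.All as All
open import Data.List.Relation.Unary.AllPairs using (AllPairs; []; _∷_)
open import Data.List.Relation.Unary.Any using (here; there)
open import Data.List.Relation.Unary.Sorted.TotalOrder.Properties using (Sorted⇒AllPairs)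
open import Data.List.Relation.Unary.Unique.Propositional.Properties using (allFin⁺)
import Data.List.Sort as Sort
open import Data.Nat as ℕ using (ℕ; zero; suc; _+_; _*_; _∸_; _≤_; z≤n; s≤s)
import Data.Nat.Properties as ℕ
open import Data.Product using (_×_; _,_; proj₁; proj₂; Σ-syntax; ∃-syntax)
open import Data.Sum using (_⊎_; inj₁; inj₂)
open import Data.Vec using ([]; _∷_; here; there; tabulate)
open import Data.Vec.Properties using (lookup⇒[]=; []=⇒lookup; lookup∘tabulate)
open import Function using (_∘_; case_of_)
open import Relation.Binary using (tri<; tri≈; tri>)
import Relation.Binary.Construct.On as On
open import Relation.Binary.Construct.Closure.Transitive using (TransClosure; [_]; _∷_)
open import Relation.Binary.PropositionalEquality
  using (_≡_; _≢_; refl; sym; trans; cong; subst; subst₂; setoid)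
open import Relation.Nullary using (¬_; yes; no; does; contradiction)
open import Relation.Nullary.Decidable using (dec-true)
open import Relation.Unary using (Decidable)

-- Subsets given by decidable predicates, and cardinality bounds.

module _ {n} {P : Fin n → Set} (P? : Decidable P) where

  -- This has the same form as `neighbours`, so the membership lemmas below apply to neighbourhoods
  -- by computation.
  comprehension : Subset n
  comprehension = tabulate (does ∘ P?)

  ∈-comprehension⁺ : ∀ {x} → P x → x ∈ comprehension
  ∈-comprehension⁺ {x} px =
    lookup⇒[]= x _ (trans (lookup∘tabulate (does ∘ P?) x) (dec-true (P? x) px))

  ∈-comprehension⁻ : ∀ {x} → x ∈ comprehension → P x
  ∈-comprehension⁻ {x} x∈ with P? x | trans (sym (lookup∘tabulate (does ∘ P?) x)) ([]=⇒lookup x∈)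
  ... | yes px | _  = px
  ... | no  _  | ()

∣p∪q∣≤∣p∣+∣q∣ : ∀ {n} (p q : Subset n) → ∣ p ∪ q ∣ ≤ ∣ p ∣ + ∣ q ∣
∣p∪q∣≤∣p∣+∣q∣ []            []            = z≤n
∣p∪q∣≤∣p∣+∣q∣ (outside ∷ p) (outside ∷ q) = ∣p∪q∣≤∣p∣+∣q∣ p q
∣p∪q∣≤∣p∣+∣q∣ (outside ∷ p) (inside  ∷ q) =
  ℕ.≤-trans (s≤s (∣p∪q∣≤∣p∣+∣q∣ p q)) (ℕ.≤-reflexive (sym (ℕ.+-suc ∣ p ∣ ∣ q ∣)))
∣p∪q∣≤∣p∣+∣q∣ (inside  ∷ p) (outside ∷ q) = s≤s (∣p∪q∣≤∣p∣+∣q∣ p q)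
∣p∪q∣≤∣p∣+∣q∣ (inside  ∷ p) (inside  ∷ q) =
  s≤s (ℕ.≤-trans (∣p∪q∣≤∣p∣+∣q∣ p q) (ℕ.+-monoʳ-≤ ∣ p ∣ (ℕ.n≤1+n ∣ q ∣)))

x∈p─q⇒x∉q : ∀ {n} {p q : Subset n} {x} → x ∈ p ─ q → x ∉ q
x∈p─q⇒x∉q {p = inside ∷ p} {q = outside ∷ q} here      ()
x∈p─q⇒x∉q {p = _ ∷ p} {q = outside ∷ q} (there x∈) (there x∈q) = x∈p─q⇒x∉q {p = p} x∈ x∈q
x∈p─q⇒x∉q {p = _ ∷ p} {q = inside  ∷ q} (there x∈) (there x∈q) = x∈p─q⇒x∉q {p = p} x∈ x∈q

∣p∣∸1≤∣p-x∣ : ∀ {n} (p : Subset n) x → ∣ p ∣ ∸ 1 ≤ ∣ p - x ∣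
∣p∣∸1≤∣p-x∣ p x = ℕ.m≤n+o⇒m∸n≤o ∣ p ∣ 1 (begin
  ∣ p ∣                  ≤⟨ p⊆q⇒∣p∣≤∣q∣ p⊆⁅x⁆∪p-x ⟩
  ∣ ⁅ x ⁆ ∪ (p - x) ∣    ≤⟨ ∣p∪q∣≤∣p∣+∣q∣ ⁅ x ⁆ (p - x) ⟩
  ∣ ⁅ x ⁆ ∣ + ∣ p - x ∣  ≡⟨ cong (_+ ∣ p - x ∣) (∣⁅x⁆∣≡1 x) ⟩
  1 + ∣ p - x ∣          ∎)
  where
  open ℕ.≤-Reasoning
  p⊆⁅x⁆∪p-x : p ⊆ ⁅ x ⁆ ∪ (p - x)
  p⊆⁅x⁆∪p-x {y} y∈p with y Fin.≟ x
  ... | yes refl = x∈p∪q⁺ (inj₁ (x∈⁅x⁆ x))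
  ... | no  y≢x  = x∈p∪q⁺ (inj₂ (x∈p∧x≢y⇒x∈p-y y∈p y≢x))

-- Eliminating nodes in order of increasing level.

module _ {n} (level : Fin n → ℕ) where

  open UGraph using (nodes; neighbours)

  -- As adjacency is symmetric, the one-sided inequality says that adjacent levels differ by at most
  -- one.
  Banded : UGraph n → Set
  Banded H = ∀ {u v} → u ~ v → level v ≤ suc (level u)
    where open UGraph H

  ⟦level≡_⟧ : ℕ → Subset n
  ⟦level≡ i ⟧ = comprehension (λ x → level x ℕ.≟ i)

  -- A fill edge joins two neighbours `u`, `v` of `x`: `v` is at most one level above `x`, and `x`
  -- is at most as high as `u`.
  eliminate-banded : ∀ {H x} → (∀ {u} → u ∈ nodes H → level x ≤ level u) →
                     Banded H → Banded (eliminate x H)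
  eliminate-banded {H} x-min band (_ , inj₁ u~v)         = band u~v
  eliminate-banded {H} x-min band (_ , inj₂ (x~u , x~v)) =
    ℕ.≤-trans (band x~v) (s≤s (x-min (UGraph.~-node H (UGraph.~-sym H x~u))))

  module _ {b} (∣levels∣≤b : ∀ i → ∣ ⟦level≡ i ⟧ ∪ ⟦level≡ suc i ⟧ ∣ ≤ b) where

    -- Minimality of `x` and the band leave only the level of `x` and the next one. The `∸ 1`
    -- accounts for `x` itself, which lies in the first of them.
    ∣neighbours∣≤ : ∀ {H x} → (∀ {u} → u ∈ nodes H → level x ≤ level u) →
                    Banded H → ∣ neighbours H x ∣ ≤ b ∸ 1
    ∣neighbours∣≤ {H} {x} x-min band = begin
      ∣ neighbours H x ∣  ≤⟨ p⊆q⇒∣p∣≤∣q∣ neighbours⊆ ⟩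
      ∣ p - x ∣           ≤⟨ ℕ.<⇒≤pred (x∈p⇒∣p-x∣<∣p∣ (x∈p∪q⁺ (inj₁ (∈level refl)))) ⟩
      ∣ p ∣ ∸ 1           ≤⟨ ℕ.∸-monoˡ-≤ 1 (∣levels∣≤b (level x)) ⟩
      b ∸ 1               ∎
      where
      open ℕ.≤-Reasoning
      open UGraph H using (_~?_; ~-node; ~-sym; ~-irr)
      p = ⟦level≡ level x ⟧ ∪ ⟦level≡ suc (level x) ⟧
      ∈level : ∀ {i v} → level v ≡ i → v ∈ ⟦level≡ i ⟧
      ∈level {i} = ∈-comprehension⁺ (λ v → level v ℕ.≟ i)
      neighbours⊆ : neighbours H x ⊆ p - x
      neighbours⊆ {v} v∈ = x∈p∧x≢y⇒x∈p-y (x∈p∪q⁺ level-v) (λ v≡x → ~-irr (sym v≡x) x~v)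
        where
        x~v = ∈-comprehension⁻ (x ~?_) v∈
        level-v : v ∈ ⟦level≡ level x ⟧ ⊎ v ∈ ⟦level≡ suc (level x) ⟧
        level-v with ℕ.m≤n⇒m<n∨m≡n (band x~v)
        ... | inj₁ lv<1+lx = inj₁ (∈level (ℕ.≤-antisym (ℕ.s≤s⁻¹ lv<1+lx) (x-min (~-node (~-sym x~v)))))
        ... | inj₂ lv≡1+lx = inj₂ (∈level lv≡1+lx)

    -- Since `σ` is sorted and contains every remaining node, its head has the least level among
    -- them, and both the band and this invariant pass to the tail.
    eliminationWidth-banded : ∀ H σ → AllPairs (λ u v → level u ≤ level v) σ →
                              (∀ {u} → u ∈ nodes H → u List.∈ σ) →
                              Banded H → eliminationWidth H σ ≤ b ∸ 1
    eliminationWidth-banded H []      _           _     _    = z≤n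
    eliminationWidth-banded H (x ∷ σ) (x≤σ ∷ σ↗) nodes⊆σ band =
      ℕ.⊔-lub (∣neighbours∣≤ {H} x-min band)
              (eliminationWidth-banded (eliminate x H) σ σ↗ nodes-x⊆σ (eliminate-banded {H} x-min band))
      where
      x-min : ∀ {u} → u ∈ nodes H → level x ≤ level u
      x-min u∈ with nodes⊆σ u∈
      ... | here refl = ℕ.≤-refl
      ... | there u∈σ = All.lookup x≤σ u∈σ
      nodes-x⊆σ : ∀ {u} → u ∈ nodes H - x → u List.∈ σ
      nodes-x⊆σ u∈ with nodes⊆σ (p─q⊆p (nodes H) ⁅ x ⁆ u∈)
      ... | here refl = contradiction (x∈⁅x⁆ x) (x∈p─q⇒x∉q {p = nodes H} u∈)
      ... | there u∈σ = u∈σ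

  sorted-ordering : ∃[ σ ] (IsOrdering σ × AllPairs (λ u v → level u ≤ level v) σ)
  sorted-ordering = sort (allFin n)
    , ( Permutationₛ.Unique-resp-↭ (setoid _) (↭⇒↭ₛ (↭-sym (sort-↭ (allFin n)))) (allFin⁺ n)
      , λ x → ∈-resp-↭ (↭-sym (sort-↭ (allFin n))) (∈-allFin x))
    , Sorted⇒AllPairs (On.totalOrder ℕ.≤-totalOrder level) (sort-↗ (allFin n))
    where open Sort (On.decTotalOrder ℕ.≤-decTotalOrder level)

-- Arrows and moral edges relative to the layers.

module _ {G : DAG} (D : LayerDecomposition G) where

  open DAG G
  open LayerDecomposition D

  layer : Fin size → ℕ
  layer x = toℕ (proj₁ (T-covers x))

  layer-T : ∀ {i x} → x ∈ T i → layer x ≡ toℕ i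
  layer-T {x = x} x∈T = cong toℕ (T-disjoint (proj₂ (T-covers x)) x∈T)

  child-in-S : ∀ j {x y} → y ∈ S j → x ⟶ y → layer x ≡ suc (toℕ j)
  child-in-S j y∈S x⟶y with view j
  ... | ‵fromℕ     = contradiction x⟶y (parents-last y∈S)
  ... | ‵inject₁ i = trans (layer-T (parents i y∈S x⟶y)) (cong suc (sym (Fin.toℕ-inject₁ i)))

  -- The conditions on children put `y` in layer `i` or the one before it. This rules out arrows
  -- from `S i` to later layers.
  child-of-S : ∀ i j {x y} → x ∈ S i → y ∈ T j → x ⟶ y → j Fin.≤ i
  child-of-S zero j x∈S y∈T x⟶y =
    ℕ.≤-reflexive (cong toℕ (T-disjoint y∈T (p─q⊆p (T zero) (S zero) (children-zero x∈S x⟶y))))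
  child-of-S (suc i) j x∈S y∈T x⟶y with x∈p∪q⁻ (T (suc i) ─ S (suc i)) _ (children-suc i x∈S x⟶y)
  ... | inj₁ y∈T─S =
    ℕ.≤-reflexive (cong toℕ (T-disjoint y∈T (p─q⊆p (T (suc i)) (S (suc i)) y∈T─S)))
  ... | inj₂ y∈S   = subst (Fin._≤ suc i) (T-disjoint (S⊆T (inject₁ i) y∈S) y∈T)
                       (ℕ.m≤n⇒m≤1+n (ℕ.≤-reflexive (Fin.toℕ-inject₁ i)))

  -- `no-crossing` covers every `i` but the last, and nothing comes after the last layer.
  T─S-isolated : ∀ i j {x y} → x ∈ T i → x ∉ S i → y ∈ T j → i Fin.< j → ¬ (x ⟶ y ⊎ y ⟶ x)
  T─S-isolated i j x∈T x∉S y∈T i<j with view i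
  ... | ‵fromℕ     = contradiction (Fin.≤fromℕ j) (ℕ.<⇒≱ i<j)
  ... | ‵inject₁ i = no-crossing i (inj₂ (x∈p∧x∉q⇒x∈p─q x∈T x∉S)) (j , i<j , y∈T)

  -- A parent in a later layer would cross from `T j ─ S j`. A parent in an earlier layer is either
  -- in `S i`, whose children lie no later, or in `T i ─ S i`, which has no arrows to later layers.
  child-outside-S : ∀ i j {x y} → x ∈ T i → y ∈ T j → y ∉ S j → x ⟶ y → i ≡ j
  child-outside-S i j {x} x∈T y∈T y∉S x⟶y with Fin.<-cmp i j
  ... | tri≈ _ i≡j _ = i≡j
  ... | tri> _ _ j<i = contradiction (inj₂ x⟶y) (T─S-isolated j i y∈T y∉S x∈T j<i)
  ... | tri< i<j _ _ with x ∈? S i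
  ...   | yes x∈S = contradiction (child-of-S i j x∈S y∈T x⟶y) (ℕ.<⇒≱ i<j)
  ...   | no  x∉S = contradiction (inj₁ x⟶y) (T─S-isolated i j x∈T x∉S y∈T i<j)

  -- Membership of `y` in its `S` decides the layer of all its parents at once: the next layer if
  -- `y` is in `S`, its own otherwise. The first component handles the edges added by moralization.
  arrow-layers : ∀ {x y} → x ⟶ y →
                 (∀ {z} → z ⟶ y → layer z ≡ layer x) ×
                 (layer x ≡ layer y ⊎ layer x ≡ suc (layer y))
  arrow-layers {x} {y} x⟶y with T-covers y
  ... | j , y∈T with y ∈? S j
  ...   | yes y∈S = (λ z⟶y → trans (child-in-S j y∈S z⟶y) (sym (child-in-S j y∈S x⟶y)))
                  , inj₂ (child-in-S j y∈S x⟶y)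
  ...   | no  y∉S = (λ z⟶y → trans (parent z⟶y) (sym (parent x⟶y)))
                  , inj₁ (parent x⟶y)
    where
    parent : ∀ {z} → z ⟶ y → layer z ≡ toℕ j
    parent {z} z⟶y = cong toℕ (child-outside-S _ j (proj₂ (T-covers z)) y∈T y∉S z⟶y)

  moralize-banded : Banded layer (moralize G)
  moralize-banded (_ , inj₁ u⟶v) with proj₂ (arrow-layers u⟶v)
  ... | inj₁ lu≡lv   = ℕ.m≤n⇒m≤1+n (ℕ.≤-reflexive (sym lu≡lv))
  ... | inj₂ lu≡1+lv = ℕ.≤-trans (ℕ.n≤1+n _) (ℕ.m≤n⇒m≤1+n (ℕ.≤-reflexive (sym lu≡1+lv)))
  moralize-banded (_ , inj₂ (inj₁ v⟶u)) with proj₂ (arrow-layers v⟶u)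
  ... | inj₁ lv≡lu   = ℕ.m≤n⇒m≤1+n (ℕ.≤-reflexive lv≡lu)
  ... | inj₂ lv≡1+lu = ℕ.≤-reflexive lv≡1+lu
  moralize-banded (_ , inj₂ (inj₂ (_ , u⟶z , v⟶z))) =
    ℕ.m≤n⇒m≤1+n (ℕ.≤-reflexive (proj₁ (arrow-layers u⟶z) v⟶z))

  ∣layer∣≤ : ∀ {w} → (∀ i → ∣ T i ∣ ≤ w) → ∀ i → ∣ ⟦level≡_⟧ layer i ∣ ≤ w
  ∣layer∣≤ ∣T∣≤w i with nonempty? (⟦level≡_⟧ layer i)
  -- A level is any natural number; those beyond `k` index no layer and are empty.
  ... | no  empty    = subst (_≤ _) (sym (trans (cong ∣_∣ (Empty-unique empty)) (∣⊥∣≡0 size))) z≤n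
  ... | yes (x , x∈) = ℕ.≤-trans (p⊆q⇒∣p∣≤∣q∣ ⊆T) (∣T∣≤w _)
    where
    level⁻ : ∀ {y} → y ∈ ⟦level≡_⟧ layer i → layer y ≡ i
    level⁻ = ∈-comprehension⁻ (λ y → layer y ℕ.≟ i)
    ⊆T : ⟦level≡_⟧ layer i ⊆ T (proj₁ (T-covers x))
    ⊆T {y} y∈ = subst (λ j → y ∈ T j)
      (Fin.toℕ-injective (trans (level⁻ y∈) (sym (level⁻ x∈)))) (proj₂ (T-covers y))

  -- Stated for one decomposition and any bound on its layers, so that it also yields the lower
  -- bound on the layerwidth of the extremal graphs.
  ordering-of-width≤ : ∀ {w} → (∀ i → ∣ T i ∣ ≤ w) →
                       ∃[ σ ] (IsOrdering σ × eliminationWidth (moralize G) σ ≤ 2 * w ∸ 1)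
  ordering-of-width≤ {w} ∣T∣≤w with sorted-ordering layer
  ... | σ , ord , σ↗ = σ , ord ,
    eliminationWidth-banded layer two-layers (moralize G) σ σ↗ (λ _ → proj₂ ord _) moralize-banded
    where
    two-layers : ∀ i → ∣ ⟦level≡_⟧ layer i ∪ ⟦level≡_⟧ layer (suc i) ∣ ≤ 2 * w
    two-layers i = ℕ.≤-trans (∣p∪q∣≤∣p∣+∣q∣ (⟦level≡_⟧ layer i) _)
      (ℕ.+-mono-≤ (∣layer∣≤ ∣T∣≤w i)
        (ℕ.≤-trans (∣layer∣≤ ∣T∣≤w (suc i)) (ℕ.≤-reflexive (sym (ℕ.+-identityʳ w)))))

treewidth≤2*layerwidth∸1 : ∀ {G w t} → IsLayerwidth G w → IsTreewidth G t → t ≤ 2 * w ∸ 1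
treewidth≤2*layerwidth∸1 ((D , ∣T∣≤w , _) , _) (_ , t-least) =
  case ordering-of-width≤ D ∣T∣≤w of λ { (σ , ord , σ≤) → ℕ.≤-trans (t-least _ (σ , ord , refl)) σ≤ }

-- Cliques bound elimination widths from below.

clique≤eliminationWidth : ∀ {n} (H : UGraph n) (C : Subset n) →
  (∀ {u v} → u ∈ C → v ∈ C → u ≢ v → UGraph._~_ H u v) →
  ∀ σ → (∀ {u} → u ∈ C → u List.∈ σ) → ∣ C ∣ ∸ 1 ≤ eliminationWidth H σ
clique≤eliminationWidth {n} H C _ [] C⊆σ =
  subst (λ m → m ∸ 1 ≤ 0) (sym (trans (cong ∣_∣ (Empty-unique C-empty)) (∣⊥∣≡0 n))) z≤n
  where
  C-empty : Empty C
  C-empty (_ , u∈C) with () ← C⊆σ u∈C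
clique≤eliminationWidth H C clique (x ∷ σ) C⊆σ with x ∈? C
-- When the first clique node is eliminated, the rest of the clique is still present among its
-- neighbours.
... | yes x∈C = ℕ.m≤n⇒m≤n⊔o _ (ℕ.≤-trans (∣p∣∸1≤∣p-x∣ C x) (p⊆q⇒∣p∣≤∣q∣ C-x⊆neighbours))
  where
  C-x⊆neighbours : C - x ⊆ UGraph.neighbours H x
  C-x⊆neighbours {v} v∈ = ∈-comprehension⁺ (UGraph._~?_ H x)
    (clique x∈C (p─q⊆p C ⁅ x ⁆ v∈)
      (λ { refl → x∈p─q⇒x∉q {p = C} v∈ (x∈⁅x⁆ x) }))
-- Eliminating a node outside `C` removes no edge within `C`.
... | no  x∉C = ℕ.m≤n⇒m≤o⊔n _ (clique≤eliminationWidth (eliminate x H) C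
    (λ u∈C v∈C u≢v → (≢x u∈C , ≢x v∈C , u≢v) , inj₁ (clique u∈C v∈C u≢v)) σ C⊆tail)
  where
  ≢x : ∀ {u} → u ∈ C → u ≢ x
  ≢x u∈C refl = x∉C u∈C
  C⊆tail : ∀ {u} → u ∈ C → u List.∈ σ
  C⊆tail u∈C with C⊆σ u∈C
  ... | here u≡x  = contradiction u≡x (≢x u∈C)
  ... | there u∈σ = u∈σ

-- The extremal graphs.

parity : ∀ {n} → Fin n → Fin 2
parity zero          = zero
parity (suc zero)    = suc zero
parity (suc (suc i)) = parity i

-- `suc w * 2` reduces to two successors over `w * 2`, exposing one node of each parity.
∣parity∣ : ∀ w i → ∣ comprehension (λ (u : Fin (w * 2)) → parity u Fin.≟ i) ∣ ≡ w
∣parity∣ zero    i          = refl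
∣parity∣ (suc w) zero       = cong suc (∣parity∣ w zero)
∣parity∣ (suc w) (suc zero) = cong suc (∣parity∣ w (suc zero))

module Extremal (w′ : ℕ) where

  w : ℕ
  w = suc w′

  -- Node `zero` alone forms the bottom layer, as a common child of layer 1; parity splits the other
  -- nodes evenly between layers 1 and 2.
  node-layer : Fin (suc (w * 2)) → Fin 3
  node-layer zero    = zero
  node-layer (suc u) = suc (parity u)

  _⟶_ : Fin (suc (w * 2)) → Fin (suc (w * 2)) → Set
  x ⟶ y = toℕ (node-layer x) ≡ suc (toℕ (node-layer y))

  ⟶⁺-decreasing : ∀ {x y} → TransClosure _⟶_ x y → node-layer y Fin.< node-layer x
  ⟶⁺-decreasing [ x⟶y ]      = ℕ.≤-reflexive (sym x⟶y)
  ⟶⁺-decreasing (x⟶y ∷ y⟶⁺z) =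
    ℕ.<-trans (⟶⁺-decreasing y⟶⁺z) (ℕ.≤-reflexive (sym x⟶y))

  G : DAG
  G = record
    { size    = suc (w * 2)
    ; _⟶_     = _⟶_
    ; _⟶?_    = λ x y → toℕ (node-layer x) ℕ.≟ suc (toℕ (node-layer y))
    ; acyclic = λ x x⟶⁺x → ℕ.<-irrefl refl (⟶⁺-decreasing x⟶⁺x)
    }

  -- With `S` full in layers 0 and 1, `no-crossing` only concerns layer 0 against layer 2. With `S`
  -- empty at the top, the conditions on children and parents there hold vacuously.
  T S : Fin 3 → Subset (suc (w * 2))
  T i = comprehension (λ x → node-layer x Fin.≟ i)

  S zero             = T zero
  S (suc zero)       = T (suc zero)
  S (suc (suc zero)) = ⊥

  T⁺ : ∀ i {x} → node-layer x ≡ i → x ∈ T i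
  T⁺ i = ∈-comprehension⁺ (λ x → node-layer x Fin.≟ i)

  T⁻ : ∀ i {x} → x ∈ T i → node-layer x ≡ i
  T⁻ i = ∈-comprehension⁻ (λ x → node-layer x Fin.≟ i)

  arrow-between : ∀ i j {x y} → x ∈ T i → y ∈ T j → x ⟶ y → toℕ i ≡ suc (toℕ j)
  arrow-between i j x∈ y∈ = subst₂ (λ i j → toℕ i ≡ suc (toℕ j)) (T⁻ i x∈) (T⁻ j y∈)

  ∉T─T : ∀ i {x} → ¬ x ∈ T i ─ T i
  ∉T─T i x∈ = x∈p─q⇒x∉q {p = T i} x∈ (p─q⊆p (T i) (T i) x∈)

  decomposition : LayerDecomposition G
  decomposition = record
    { k = 2
    ; T = T
    ; S = S
    ; T-nonempty    = λ { zero → zero , T⁺ zero refl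
                        ; (suc zero) → suc zero , T⁺ (suc zero) refl
                        ; (suc (suc zero)) → suc (suc zero) , T⁺ (suc (suc zero)) refl }
    ; T-disjoint    = λ {i} {j} x∈Ti x∈Tj → trans (sym (T⁻ i x∈Ti)) (T⁻ j x∈Tj)
    ; T-covers      = λ x → node-layer x , T⁺ (node-layer x) refl
    ; S⊆T           = λ { zero x∈ → x∈
                        ; (suc zero) x∈ → x∈
                        ; (suc (suc zero)) x∈ → contradiction x∈ ∉⊥ }
    ; no-crossing   = no-crossing
    ; children-suc  = λ { zero {x} {y} x∈ x⟶y →
                            q⊆p∪q (T (suc zero) ─ T (suc zero)) _ (child∈T zero {x} {y} x∈ x⟶y)
                        ; (suc zero) x∈ → contradiction x∈ ∉⊥ }
    ; children-zero = λ {x} {y} x∈ x⟶y →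
                        contradiction (arrow-between zero (node-layer y) x∈ (T⁺ _ refl) x⟶y) λ ()
    ; parents       = λ { zero {x} {y} x∈ y⟶x → parent∈T zero {x} {y} x∈ y⟶x
                        ; (suc zero) {x} {y} x∈ y⟶x → parent∈T (suc zero) {x} {y} x∈ y⟶x }
    ; parents-last  = λ x∈ → contradiction x∈ ∉⊥
    }
    where
    child∈T : ∀ i {x y} → x ∈ T (suc i) → x ⟶ y → y ∈ T (inject₁ i)
    child∈T i {x} {y} x∈ x⟶y = T⁺ _ (Fin.toℕ-injective (trans
      (ℕ.suc-injective (sym (arrow-between (suc i) (node-layer y) x∈ (T⁺ _ refl) x⟶y)))
      (sym (Fin.toℕ-inject₁ i))))
    parent∈T : ∀ i {x y} → x ∈ T (inject₁ i) → y ⟶ x → y ∈ T (suc i)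
    parent∈T i {x} {y} x∈ y⟶x = T⁺ _ (Fin.toℕ-injective (trans
      (arrow-between (node-layer y) (inject₁ i) (T⁺ _ refl) x∈ y⟶x)
      (cong suc (Fin.toℕ-inject₁ i))))
    no-crossing : ∀ (i : Fin 2) {x y} →
      (∃[ h ] (h Fin.< inject₁ i × x ∈ T h)) ⊎ x ∈ T (inject₁ i) ─ S (inject₁ i) →
      ∃[ j ] (inject₁ i Fin.< j × y ∈ T j) → ¬ (x ⟶ y ⊎ y ⟶ x)
    no-crossing zero       (inj₂ x∈) _ _ = ∉T─T zero x∈
    no-crossing (suc zero) (inj₂ x∈) _ _ = ∉T─T (suc zero) x∈
    no-crossing (suc zero) (inj₁ (suc _ , s≤s () , _)) _ _
    no-crossing (suc zero) (inj₁ (zero , _ , x∈)) (suc zero , s≤s () , _) _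
    no-crossing (suc zero) (inj₁ (zero , _ , x∈)) (suc (suc zero) , _ , y∈) (inj₁ x⟶y) =
      contradiction (arrow-between zero (suc (suc zero)) x∈ y∈ x⟶y) λ ()
    no-crossing (suc zero) (inj₁ (zero , _ , x∈)) (suc (suc zero) , _ , y∈) (inj₂ y⟶x) =
      contradiction (arrow-between (suc (suc zero)) zero y∈ x∈ y⟶x) λ ()

  ∣T∣≤w : ∀ i → ∣ T i ∣ ≤ w
  -- Equality tests on successors compute to tests on parities, and node `zero` contributes nothing.
  ∣T∣≤w (suc i) = ℕ.≤-reflexive (∣parity∣ w i)
  ∣T∣≤w zero    = ℕ.≤-trans (p⊆q⇒∣p∣≤∣q∣ T⊆⁅0⁆)
                    (ℕ.≤-trans (ℕ.≤-reflexive (∣⁅x⁆∣≡1 {suc (w * 2)} zero)) (s≤s z≤n))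
    where
    T⊆⁅0⁆ : T zero ⊆ ⁅ zero ⁆
    T⊆⁅0⁆ {zero}  _  = here
    T⊆⁅0⁆ {suc u} u∈ with () ← T⁻ zero u∈

  open UGraph (moralize G) using (_~_)

  -- Nodes in different layers are joined by an arrow. Nodes of layer 1 share the child `zero`, and
  -- those of layer 2 share the child `suc zero`, which lies in layer 1.
  upper-clique : ∀ {u v} → u ∈ outside ∷ ⊤ {w * 2} → v ∈ outside ∷ ⊤ → u ≢ v → u ~ v
  upper-clique {suc u} {suc v} _ _ u≢v = u≢v , adjacent
    where
    adjacent : suc u ⟶ suc v ⊎ suc v ⟶ suc u ⊎ ∃[ z ] (suc u ⟶ z × suc v ⟶ z)
    adjacent with parity u | parity v
    ... | zero     | zero     = inj₂ (inj₂ (zero , refl , refl))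
    ... | zero     | suc zero = inj₂ (inj₁ refl)
    ... | suc zero | zero     = inj₁ refl
    ... | suc zero | suc zero = inj₂ (inj₂ (suc zero , refl , refl))

  2w∸1≤eliminationWidth : ∀ {σ} → IsOrdering σ → 2 * w ∸ 1 ≤ eliminationWidth (moralize G) σ
  2w∸1≤eliminationWidth {σ} (_ , complete) =
    subst (λ m → m ∸ 1 ≤ eliminationWidth (moralize G) σ) (trans (∣⊤∣≡n (w * 2)) (ℕ.*-comm w 2))
      (clique≤eliminationWidth (moralize G) (outside ∷ ⊤) upper-clique σ (λ _ → complete _))

  -- Layers of size at most `w″` give an ordering of width at most `2 * w″ ∸ 1`, while the clique
  -- forces at least `2 * w ∸ 1`.
  w≤layers : ∀ (D : LayerDecomposition G) {w″} →
             (∀ i → ∣ LayerDecomposition.T D i ∣ ≤ w″) → w ≤ w″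
  w≤layers D {w″} ∣T∣≤w″ with ordering-of-width≤ D ∣T∣≤w″
  ... | σ , ord , σ≤ with ℕ.pred-cancel-≤ (ℕ.≤-trans (2w∸1≤eliminationWidth ord) σ≤)
  -- Truncated subtraction leaves the case `2 * w ≡ 1`, impossible for an even number.
  ...   | inj₁ (2w≡1 , _) = contradiction (trans (sym (ℕ.+-suc w′ _)) (ℕ.suc-injective 2w≡1)) λ ()
  ...   | inj₂ 2w≤2w″     = ℕ.*-cancelˡ-≤ 2 2w≤2w″

  layerwidth : IsLayerwidth G w
  -- `w≤layers` serves twice: for the exact width of `decomposition` and for minimality over all
  -- decompositions.
  layerwidth = (decomposition , ∣T∣≤w , λ _ → w≤layers decomposition)
             , λ { _ (D , ∣T∣≤ , _) → w≤layers D ∣T∣≤ }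

  treewidth : IsTreewidth G (2 * w ∸ 1)
  treewidth with ordering-of-width≤ decomposition ∣T∣≤w
  ... | σ , ord , σ≤ = (σ , ord , ℕ.≤-antisym σ≤ (2w∸1≤eliminationWidth ord))
                     , λ { _ (_ , ord′ , refl) → 2w∸1≤eliminationWidth ord′ }

theorem9 : (∀ (G : DAG) (w t : ℕ) → IsLayerwidth G w → IsTreewidth G t → t ≤ 2 * w ∸ 1)
    × (∀ (w : ℕ) → 1 ≤ w → Σ[ G ∈ DAG ] (IsLayerwidth G w × IsTreewidth G (2 * w ∸ 1)))
theorem9 = (λ G w t → treewidth≤2*layerwidth∸1)
         , λ { (suc w′) _ → let open Extremal w′ in G , layerwidth , treewidth }
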